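{- A tree $T$ is $(\iota,1)$-critical if and only if $T\in\mathcal{F}_\iota$.
   Context: For $D\subseteq V(T)$, $N[D]$ is $D$ with all neighbours; $D$ is isolating if $T-N[D]$ has no edges; $\iota(T)$ is the minimum size of an isolating set. $T_e$ is obtained by subdividing edge $e$ once. $T$ is $(\iota,1)$-critical if $\iota(T_e)>\iota(T)$ for every edge $e$ (and $T$ has an edge). The family $\mathcal{F}_\iota$ consists of trees $T$ for which there is a sequence $T_1,\dots,T_j$ ($j\ge1$) with $T_1=P_5$, $T_j=T$, each $T_{i+1}$ obtained from $T_i$ by one of the operations below, where each vertex carries a status $A$, $B$ or $C$ that, once assigned, never changes. In $T_1=P_5$ the middle vertex has status $A$, the two support vertices have status $B$, the two leaves have status $C$. Operation $\mathcal{O}_1$: add a new vertex $x$ and an edge $xy$ where $y$ has status $B$; the new vertex $x$ gets status $C$. Operation $\mathcal{O}_2$: add a path $u v$ and an edge $xu$ where $x$ has status $A$; $u$ gets status $B$ and $v$ gets status $C$. Operation $\mathcal{O}_3$: add a path $u v w z$ and an edge $xu$ where $x$ has status $C$; $u,v,w,z$ get statuses $B,A,B,C$ respectively. -}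

module Defs where

open import Data.Nat using (ℕ; zero; suc; _+_; _<_; _≤_)
open import Data.Fin using (Fin; zero; suc)
open import Data.Fin.Subset using (Subset; ∣_∣) renaming (_∈_ to _∈ₛ_)
open import Data.List using (List; []; _∷_; length; map)
open import Data.List.Membership.Propositional using (_∈_)
open import Data.List.Relation.Unary.AllPairs using (AllPairs)
open import Data.Product using (Σ; ∃; _×_; _,_)
open import Data.Sum using (_⊎_)
open import Data.Vec.Functional using (Vector) renaming (_∷_ to _∷ᵥ_)
open import Relation.Binary.PropositionalEquality using (_≡_; _≢_)
open import Relation.Binary.Construct.Closure.ReflexiveTransitive using (Star)
open import Relation.Nullary using (¬_)
open import Function.Bundles using (_↔_; Inverse; _⇔_)

-- A (multi)graph on vertex set Fin n is given by a list of edges.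
Edge : ℕ → Set
Edge n = Fin n × Fin n

Edges : ℕ → Set
Edges n = List (Edge n)

Adj : ∀ {n} → Edges n → Fin n → Fin n → Set
Adj es x y = ((x , y) ∈ es) ⊎ ((y , x) ∈ es)

SameEdge : ∀ {n} → Edge n → Edge n → Set
SameEdge (a , b) (c , d) = ((a ≡ c) × (b ≡ d)) ⊎ ((a ≡ d) × (b ≡ c))

Connected : ∀ {n} → Edges n → Set
Connected {n} es = ∀ (x y : Fin n) → Star (Adj es) x y

IsTree : (n : ℕ) → Edges n → Set
IsTree n es =
  (∀ a b → (a , b) ∈ es → a ≢ b)
  × AllPairs (λ e f → ¬ SameEdge e f) es
  × Connected es
  × (suc (length es) ≡ n)

InClosedNbhd : ∀ {n} → Edges n → Subset n → Fin n → Set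
InClosedNbhd es D x = (x ∈ₛ D) ⊎ (∃ λ y → (y ∈ₛ D) × Adj es x y)

-- T - N[D] has no edges: every edge has an endpoint in N[D]
Isolating : ∀ {n} → Edges n → Subset n → Set
Isolating es D = ∀ u v → (u , v) ∈ es → InClosedNbhd es D u ⊎ InClosedNbhd es D v

IsIota : ∀ {n} → Edges n → ℕ → Set
IsIota {n} es k =
  (Σ (Subset n) λ D → Isolating es D × ∣ D ∣ ≡ k)
  × (∀ (D : Subset n) → Isolating es D → k ≤ ∣ D ∣)

-- Subdivision. New vertices are placed at index zero; old vertex i becomes suc i.

liftE : ∀ {n} → Edge n → Edge (suc n)
liftE (a , b) = (suc a , suc b)

liftEs : ∀ {n} → Edges n → Edges (suc n)
liftEs = map liftE

subdivide : ∀ {n} → (es : Edges n) → Fin (length es) → Edges (suc n)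
subdivide ((a , b) ∷ es) zero = (suc a , zero) ∷ (zero , suc b) ∷ liftEs es
subdivide (e ∷ es) (suc i) = liftE e ∷ subdivide es i

IotaCritical : ∀ {n} → Edges n → Set
IotaCritical es =
  (es ≢ [])
  × (∀ (e : Fin (length es)) (k k' : ℕ) → IsIota es k → IsIota (subdivide es e) k' → k < k')

data Status : Set where
  A B C : Status

P5-edges : Edges 5
P5-edges = (zero , suc zero) ∷ (suc zero , suc (suc zero))
         ∷ (suc (suc zero) , suc (suc (suc zero)))
         ∷ (suc (suc (suc zero)) , suc (suc (suc (suc zero)))) ∷ []

P5-status : Vector Status 5
P5-status = C ∷ᵥ B ∷ᵥ A ∷ᵥ B ∷ᵥ C ∷ᵥ λ ()

data Built : (n : ℕ) → Edges n → Vector Status n → Set where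
  base : Built 5 P5-edges P5-status
  op1 : ∀ {n es st} → Built n es st → (y : Fin n) → st y ≡ B →
        Built (suc n) ((zero , suc y) ∷ liftEs es) (C ∷ᵥ st)
  op2 : ∀ {n es st} → Built n es st → (x : Fin n) → st x ≡ A →
        Built (suc (suc n))
              ((suc (suc x) , suc zero) ∷ (suc zero , zero) ∷ liftEs (liftEs es))
              (C ∷ᵥ B ∷ᵥ st)
  op3 : ∀ {n es st} → Built n es st → (x : Fin n) → st x ≡ C →
        Built (suc (suc (suc (suc n))))
              ((suc (suc (suc (suc x))) , suc (suc (suc zero)))
                ∷ (suc (suc (suc zero)) , suc (suc zero))
                ∷ (suc (suc zero) , suc zero)
                ∷ (suc zero , zero)
                ∷ liftEs (liftEs (liftEs (liftEs es))))
              (C ∷ᵥ B ∷ᵥ A ∷ᵥ B ∷ᵥ st)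

Isomorphic : ∀ {n m} → Edges n → Edges m → Set
Isomorphic {n} {m} es fs =
  Σ (Fin n ↔ Fin m) λ f → ∀ x y → Adj es x y ⇔ Adj fs (Inverse.to f x) (Inverse.to f y)

InFamily : ∀ {n} → Edges n → Set
InFamily es = Σ ℕ λ m → Σ (Edges m) λ fs → Σ (Vector Status m) λ st →
  Built m fs st × Isomorphic es fs

{-# OPTIONS --safe #-}

-- Membership in the family amounts to a local labelling: neighbours of A- and C-vertices have status B, every
-- A-vertex has at least two neighbours, and every B-vertex has one A-neighbour, at least one C-neighbour and
-- no B-neighbour. If the tree is critical, a minimum isolating set D gives such a labelling with A = D,
-- B = N(D) \ D and C the rest, since any violation yields an isolating set of size |D| after subdividing a
-- suitable edge. A labelled tree is grown from a C-root by the operations, keeping the image closed under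
-- parents. Conversely the A-vertices of a labelled tree form an isolating set, and after subdividing any edge
-- there are |A| + 1 edges with pairwise disjoint closed neighbourhoods, so ι increases.
module Submission where

open import Defs
open import Data.Bool using (true; false)
open import Data.Fin using (Fin; zero; suc; punchIn; punchOut)
open import Data.Fin.Properties using (_≟_; any?; all?; injective⇒≤; punchIn-injective; punchInᵢ≢i;
  punchOut-injective; suc-injective)
open import Data.Fin.Subset using (Subset; ∣_∣; _-_; inside; outside; ⊤) renaming (_∈_ to _∈ₛ_; _∉_ to _∉ₛ_)
open import Data.Fin.Subset.Properties using (_∈?_; anySubset?; ∈⊤; x∈p∧x≢y⇒x∈p-y; x∈p⇒∣p-x∣<∣p∣)
open import Data.List using ([]; _∷_; length; lookup)
open import Data.List.Membership.Propositional using (_∈_)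
open import Data.List.Membership.Propositional.Properties using (∈-map⁺; ∈-map⁻; ∈-lookup)
open import Data.List.Membership.DecPropositional using () renaming (_∈?_ to member?)
open import Data.List.Relation.Unary.All as All using ()
open import Data.List.Relation.Unary.AllPairs using (AllPairs; _∷_)
open import Data.List.Relation.Unary.Any using (here; there; index)
open import Data.List.Relation.Unary.Any.Properties using (lookup-index)
open import Data.Nat using (ℕ; zero; suc; _+_; _<_; _≤_; z≤n; s≤s)
import Data.Nat.Properties as ℕ
open import Data.Product using (∃; ∃₂; _×_; _,_; proj₁; proj₂)
open import Data.Product.Properties using (≡-dec)
open import Data.Sum as Sum using (_⊎_; inj₁; inj₂; [_,_]′)
open import Data.Vec using (_∷_; []; tabulate; here; there)
open import Data.Vec.Properties using (lookup∘tabulate; lookup⇒[]=; []=⇒lookup)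
open import Data.Vec.Functional using (Vector) renaming (_∷_ to _∷ᵥ_)
open import Function using (_∘_)
open import Function.Bundles using (_⇔_; mk⇔; mk↔ₛ′; Inverse; Equivalence)
open import Relation.Binary.Construct.Closure.ReflexiveTransitive using (Star; ε; _◅_)
open import Relation.Binary.PropositionalEquality using (_≡_; _≢_; refl; sym; trans; cong; subst)
open import Relation.Nullary using (¬_; Dec; yes; no; does; contradiction; _×-dec_; _⊎-dec_; _→-dec_)
open import Relation.Nullary.Decidable using (dec-true; decidable-stable; ¬?)

private
  variable
    n m : ℕ
    es fs gs : Edges n

-- Least witnesses, injections between finite sets, and sizes of subsets.

least : {P : ℕ → Set} → (∀ k → Dec (P k)) → ∀ {k} → P k →
        ∃ λ l → P l × (∀ j → P j → l ≤ j)
least P? {k} pk with P? zero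
least P? {k} pk | yes p0 = zero , p0 , λ _ _ → z≤n
least P? {zero} pk | no ¬p0 = contradiction pk ¬p0
least P? {suc k} pk | no ¬p0 with least (P? ∘ suc) pk
... | l , pl , min = suc l , pl , λ where
  zero p0 → contradiction p0 ¬p0
  (suc j) pj → s≤s (min j pj)

non-surjective⇒< : {f : Fin m → Fin n} → (∀ {i j} → f i ≡ f j → i ≡ j) →
                   ∀ i → (∀ j → f j ≢ i) → m < n
non-surjective⇒< {n = suc n} inj i miss =
  s≤s (injective⇒≤ {f = λ j → punchOut (miss j ∘ sym)} (inj ∘ punchOut-injective (miss _ ∘ sym) (miss _ ∘ sym)))

injective⇒surjective : n ≤ m → {f : Fin m → Fin n} → (∀ {i j} → f i ≡ f j → i ≡ j) →
                       ∀ i → ∃ λ j → f j ≡ i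
injective⇒surjective n≤m {f} inj i with any? (λ j → f j ≟ i)
... | yes hit = hit
... | no miss = contradiction (non-surjective⇒< inj i λ j e → miss (j , e)) (ℕ.≤⇒≯ n≤m)

comprehension : {P : Fin n → Set} → (∀ x → Dec (P x)) → Subset n
comprehension P? = tabulate (does ∘ P?)

∈-comprehension⁺ : {P : Fin n → Set} (P? : ∀ x → Dec (P x)) → ∀ {x} → P x → x ∈ₛ comprehension P?
∈-comprehension⁺ P? {x} px =
  lookup⇒[]= x _ (trans (lookup∘tabulate (does ∘ P?) x) (dec-true (P? x) px))

∈-comprehension⁻ : {P : Fin n → Set} (P? : ∀ x → Dec (P x)) → ∀ {x} → x ∈ₛ comprehension P? → P x
∈-comprehension⁻ P? {x} x∈ with P? x | trans (sym (lookup∘tabulate (does ∘ P?) x)) ([]=⇒lookup x∈)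
... | yes px | _ = px
... | no _   | ()

-- A relation rather than a function, so that the partner of `x` may depend on the proof of
-- membership in `P`. The induction deletes each chosen partner from `Q`; injectivity of `R` keeps
-- it from being chosen again.
∣∣-mono-injective : (R : Fin n → Fin m → Set) → (∀ {x x′ y} → R x y → R x′ y → x ≡ x′) →
                    (P : Subset n) (Q : Subset m) →
                    (∀ {x} → x ∈ₛ P → ∃ λ y → y ∈ₛ Q × R x y) → ∣ P ∣ ≤ ∣ Q ∣
∣∣-mono-injective R inj [] Q total = z≤n
∣∣-mono-injective R inj (false ∷ P) Q total =
  ∣∣-mono-injective (R ∘ suc) (λ r r′ → suc-injective (inj r r′)) P Q (total ∘ there)
∣∣-mono-injective R inj (true ∷ P) Q total with total here
... | y₀ , y₀∈Q , r₀ = ℕ.≤-<-trans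
  (∣∣-mono-injective (R ∘ suc) (λ r r′ → suc-injective (inj r r′)) P (Q - y₀) λ x∈P →
    let y , y∈Q , r = total (there x∈P)
    in y , x∈p∧x≢y⇒x∈p-y y∈Q (λ where refl → contradiction (inj r r₀) λ ()) , r)
  (x∈p⇒∣p-x∣<∣p∣ y₀∈Q)

-- Adjacency and minimum isolating sets

adj-sym : ∀ {x y} → Adj es x y → Adj es y x
adj-sym = Sum.swap

adj? : (es : Edges n) → ∀ x y → Dec (Adj es x y)
adj? es x y = member? (≡-dec _≟_ _≟_) (x , y) es ⊎-dec member? (≡-dec _≟_ _≟_) (y , x) es

sameEdge-sym : {e f : Edge n} → SameEdge e f → SameEdge f e
sameEdge-sym (inj₁ (refl , refl)) = inj₁ (refl , refl)
sameEdge-sym (inj₂ (refl , refl)) = inj₂ (refl , refl)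

sameEdge-trans : {e f g : Edge n} → SameEdge e f → SameEdge f g → SameEdge e g
sameEdge-trans (inj₁ (refl , refl)) f≈g = f≈g
sameEdge-trans (inj₂ (refl , refl)) (inj₁ (refl , refl)) = inj₂ (refl , refl)
sameEdge-trans (inj₂ (refl , refl)) (inj₂ (refl , refl)) = inj₁ (refl , refl)

sameEdge-swapˡ : ∀ {x y : Fin n} {f} → SameEdge (x , y) f → SameEdge (y , x) f
sameEdge-swapˡ (inj₁ (refl , refl)) = inj₂ (refl , refl)
sameEdge-swapˡ (inj₂ (refl , refl)) = inj₁ (refl , refl)

sameEdge-swapʳ : ∀ {x y : Fin n} {e} → SameEdge e (x , y) → SameEdge e (y , x)
sameEdge-swapʳ = Sum.swap

adj-index : ∀ {x y} → Adj es x y → ∃ λ i → SameEdge (x , y) (lookup es i)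
adj-index (inj₁ e∈) = index e∈ , inj₁ (cong proj₁ (lookup-index e∈) , cong proj₂ (lookup-index e∈))
adj-index (inj₂ e∈) = index e∈ , inj₂ (cong proj₂ (lookup-index e∈) , cong proj₁ (lookup-index e∈))

inClosedNbhd? : (es : Edges n) (D : Subset n) → ∀ x → Dec (InClosedNbhd es D x)
inClosedNbhd? es D x = x ∈? D ⊎-dec any? (λ y → y ∈? D ×-dec adj? es x y)

isolating? : (es : Edges n) (D : Subset n) → Dec (Isolating es D)
isolating? es D = all? λ u → all? λ v → member? (≡-dec _≟_ _≟_) (u , v) es
  →-dec (inClosedNbhd? es D u ⊎-dec inClosedNbhd? es D v)

isolating-adj : ∀ {D u v} → Isolating es D → Adj es u v → InClosedNbhd es D u ⊎ InClosedNbhd es D v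
isolating-adj iso (inj₁ uv∈) = iso _ _ uv∈
isolating-adj iso (inj₂ vu∈) = Sum.swap (iso _ _ vu∈)

-- The full vertex set is isolating, which starts the search for the least size. `IotaCritical` only
-- speaks about given values of ι, so their existence has to be supplied before it says anything.
iota-exists : (es : Edges n) → ∃ (IsIota es)
iota-exists es =
  let k , attained , min = least
        (λ k → anySubset? λ D → isolating? es D ×-dec (∣ D ∣ ℕ.≟ k))
        (⊤ , (λ _ _ _ → inj₁ (inj₁ ∈⊤)) , refl)
  in k , attained , λ D iso → min _ (D , iso , refl)

-- Rooted trees

-- Acyclicity is the field `adj-cases`. Setting `parent r ≡ r` keeps `parent` total, and iterated
-- parents stay at the root.
record Rooted (es : Edges n) (r : Fin n) : Set where
  field
    parent       : Fin n → Fin n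
    depth        : Fin n → ℕ
    parent-root  : parent r ≡ r
    depth-parent : ∀ {v} → v ≢ r → depth (parent v) < depth v
    adj-parent   : ∀ {v} → v ≢ r → Adj es v (parent v)
    adj-cases    : ∀ {u v} → Adj es u v → (u ≢ r × parent u ≡ v) ⊎ (v ≢ r × parent v ≡ u)

  child : ∀ {u v} → Adj es u v → v ≢ parent u → v ≢ r × parent v ≡ u
  child uv v≢ = [ (λ where (_ , refl) → contradiction refl v≢) , (λ c → c) ]′ (adj-cases uv)

-- Walks of exact length: decidable by recursion on the length, so `least` yields the distance to
-- `r`.
Reach : Edges n → Fin n → ℕ → Fin n → Set
Reach es r zero v = v ≡ r
Reach es r (suc k) v = ∃ λ y → Adj es v y × Reach es r k y

reach? : (es : Edges n) (r : Fin n) → ∀ k v → Dec (Reach es r k v)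
reach? es r zero v = v ≟ r
reach? es r (suc k) v = any? λ y → adj? es v y ×-dec reach? es r k y

star⇒reach : ∀ {v r} → Star (Adj es) v r → ∃ λ k → Reach es r k v
star⇒reach ε = zero , refl
star⇒reach (vy ◅ w) = let k , p = star⇒reach w in suc k , _ , vy , p

-- The n − 1 edges joining a vertex to its parent are distinct, hence they are all the edges.
rooted : IsTree n es → (r : Fin n) → Rooted es r
rooted {n = suc n} {es = es} (_ , _ , connected , edges) r = record
  { parent = parent ; depth = dist ; parent-root = proj₁ (proj₂ (step r (r ≟ r))) refl
  ; depth-parent = λ {v} v≢r → proj₂ (proj₂ (proj₂ (step v (v ≟ r))) v≢r)
  ; adj-parent = adj-parent ; adj-cases = adj-cases }
  where
  distance : ∀ v → ∃ λ l → Reach es r l v × (∀ j → Reach es r j v → l ≤ j)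
  distance v = least (λ k → reach? es r k v) (proj₂ (star⇒reach (connected v r)))

  dist : Fin (suc n) → ℕ
  dist v = proj₁ (distance v)

  next : ∀ {v} l → Reach es r l v → v ≢ r → ∃ λ y → Adj es v y × dist y < l
  next zero v≡r v≢r = contradiction v≡r v≢r
  next (suc l) (y , vy , reach) _ = y , vy , s≤s (proj₂ (proj₂ (distance y)) l reach)

  step : ∀ v → Dec (v ≡ r) → ∃ λ y → (v ≡ r → y ≡ r) × (v ≢ r → Adj es v y × dist y < dist v)
  step v (yes v≡r) = r , (λ _ → refl) , λ v≢r → contradiction v≡r v≢r
  step v (no v≢r) = let y , closer = next (dist v) (proj₁ (proj₂ (distance v))) v≢r
                    in y , (λ v≡r → contradiction v≡r v≢r) , λ _ → closer

  parent : Fin (suc n) → Fin (suc n)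
  parent v = proj₁ (step v (v ≟ r))

  adj-parent : ∀ {v} → v ≢ r → Adj es v (parent v)
  adj-parent {v} v≢r = proj₁ (proj₂ (proj₂ (step v (v ≟ r))) v≢r)

  closer : ∀ {v} → v ≢ r → dist (parent v) < dist v
  closer {v} v≢r = proj₂ (proj₂ (proj₂ (step v (v ≟ r))) v≢r)

  parentEdge : ∀ j → ∃ λ i → SameEdge (punchIn r j , parent (punchIn r j)) (lookup es i)
  parentEdge j = adj-index (adj-parent (punchInᵢ≢i r j))

  -- If the two parent edges agreed with opposite orientations, `u` and `v` would be each other's
  -- parent, and each would be strictly closer to the root than the other.
  determined : ∀ {u v} → u ≢ r → v ≢ r → ∀ {e} →
               SameEdge (u , parent u) e → SameEdge (v , parent v) e → u ≡ v
  determined u≢r v≢r (inj₁ (refl , _)) (inj₁ (refl , _)) = refl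
  determined u≢r v≢r (inj₂ (refl , _)) (inj₂ (refl , _)) = refl
  determined {u} {v} u≢r v≢r (inj₁ (refl , refl)) (inj₂ (v≡pu , pv≡u)) = contradiction
    (closer u≢r) (ℕ.<-asym (subst (λ w → dist w < dist (parent u)) pv≡u
      (subst (λ w → dist (parent v) < dist w) v≡pu (closer v≢r))))
  determined {u} {v} u≢r v≢r (inj₂ (refl , refl)) (inj₁ (v≡pu , pv≡u)) = contradiction
    (closer u≢r) (ℕ.<-asym (subst (λ w → dist w < dist (parent u)) pv≡u
      (subst (λ w → dist (parent v) < dist w) v≡pu (closer v≢r))))

  parentEdge-injective : ∀ {j k} → proj₁ (parentEdge j) ≡ proj₁ (parentEdge k) → j ≡ k
  parentEdge-injective {j} {k} eq = punchIn-injective r j k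
    (determined (punchInᵢ≢i r j) (punchInᵢ≢i r k)
      (subst (λ i → SameEdge _ (lookup es i)) eq (proj₂ (parentEdge j))) (proj₂ (parentEdge k)))

  adj-cases : ∀ {u v} → Adj es u v → (u ≢ r × parent u ≡ v) ⊎ (v ≢ r × parent v ≡ u)
  adj-cases uv =
    let i , uv≈ = adj-index uv
        j , j↦i = injective⇒surjective (ℕ.≤-reflexive (ℕ.suc-injective edges)) parentEdge-injective i
        w≈ = subst (λ i → SameEdge (punchIn r j , parent (punchIn r j)) (lookup es i)) j↦i (proj₂ (parentEdge j))
    in orient (punchInᵢ≢i r j) (sameEdge-trans w≈ (sameEdge-sym uv≈))
    where
    orient : ∀ {w u v} → w ≢ r → SameEdge (w , parent w) (u , v) →
             (u ≢ r × parent u ≡ v) ⊎ (v ≢ r × parent v ≡ u)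
    orient w≢r (inj₁ (refl , p)) = inj₁ (w≢r , p)
    orient w≢r (inj₂ (refl , p)) = inj₂ (w≢r , p)

-- Subdivision

-- A description by adjacency alone, independent of list order and symmetric in the two ends, so
-- that either end can be given the distinguished role.
record IsSubdivision (es : Edges n) (gs : Edges (suc n)) (a b : Fin n) : Set where
  field
    new-left  : Adj gs (suc a) zero
    new-right : Adj gs (suc b) zero
    old⁺      : ∀ {u v} → Adj es u v → ¬ SameEdge (u , v) (a , b) → Adj gs (suc u) (suc v)
    old⁻      : ∀ {u v} → Adj gs (suc u) (suc v) → Adj es u v × ¬ SameEdge (u , v) (a , b)
    new⁻      : ∀ {u} → Adj gs (suc u) zero → u ≡ a ⊎ u ≡ b
    no-loop   : ¬ Adj gs zero zero

subdivision-swap : ∀ {a b} → IsSubdivision es gs a b → IsSubdivision es gs b a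
subdivision-swap S = record
  { new-left = new-right ; new-right = new-left
  ; old⁺ = λ uv ≠ab → old⁺ uv (≠ab ∘ sameEdge-swapʳ)
  ; old⁻ = λ uv → let uv′ , ≠ab = old⁻ uv in uv′ , ≠ab ∘ sameEdge-swapʳ
  ; new⁻ = Sum.swap ∘ new⁻ ; no-loop = no-loop }
  where open IsSubdivision S

subdivide-new : (es : Edges n) (i : Fin (length es)) → let a , b = lookup es i in
                (suc a , zero) ∈ subdivide es i × (zero , suc b) ∈ subdivide es i
subdivide-new (e ∷ es) zero = here refl , there (here refl)
subdivide-new (e ∷ es) (suc i) = let p , q = subdivide-new es i in there p , there q

subdivide-old : (es : Edges n) (i : Fin (length es)) → ∀ {f} → f ∈ es → ¬ SameEdge f (lookup es i) →
                liftE f ∈ subdivide es i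
subdivide-old (e ∷ es) zero (here refl) ≠e = contradiction (inj₁ (refl , refl)) ≠e
subdivide-old (e ∷ es) zero (there f∈) ≠e = there (there (∈-map⁺ liftE f∈))
subdivide-old (e ∷ es) (suc i) (here refl) ≠e = here refl
subdivide-old (e ∷ es) (suc i) (there f∈) ≠e = there (subdivide-old es i f∈ ≠e)

-- Distinctness of the edges matters here: a second copy of the subdivided edge, in either
-- orientation, would survive in the list.
subdivide⁻ : (es : Edges n) → AllPairs (λ e f → ¬ SameEdge e f) es → (i : Fin (length es)) →
             ∀ {g} → g ∈ subdivide es i → let a , b = lookup es i in
             (g ≡ (suc a , zero)) ⊎ (g ≡ (zero , suc b)) ⊎
             ∃ λ f → g ≡ liftE f × f ∈ es × ¬ SameEdge f (lookup es i)
subdivide⁻ (e ∷ es) (_ ∷ _) zero (here refl) = inj₁ refl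
subdivide⁻ (e ∷ es) (_ ∷ _) zero (there (here refl)) = inj₂ (inj₁ refl)
subdivide⁻ (e ∷ es) (e≁ ∷ _) zero (there (there g∈)) with ∈-map⁻ liftE g∈
... | f , f∈ , refl = inj₂ (inj₂ (f , refl , there f∈ , All.lookup e≁ f∈ ∘ sameEdge-sym))
subdivide⁻ (e ∷ es) (e≁ ∷ _) (suc i) (here refl) =
  inj₂ (inj₂ (e , refl , here refl , All.lookup e≁ (∈-lookup i)))
subdivide⁻ (e ∷ es) (_ ∷ distinct) (suc i) (there g∈) with subdivide⁻ es distinct i g∈
... | inj₁ g≡ = inj₁ g≡
... | inj₂ (inj₁ g≡) = inj₂ (inj₁ g≡)
... | inj₂ (inj₂ (f , g≡ , f∈ , ≠e)) = inj₂ (inj₂ (f , g≡ , there f∈ , ≠e))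

subdivide-isSubdivision : (es : Edges n) → AllPairs (λ e f → ¬ SameEdge e f) es → (i : Fin (length es)) →
  IsSubdivision es (subdivide es i) (proj₁ (lookup es i)) (proj₂ (lookup es i))
subdivide-isSubdivision es distinct i = record
  { new-left = inj₁ (proj₁ (subdivide-new es i))
  ; new-right = inj₂ (proj₂ (subdivide-new es i))
  ; old⁺ = λ where
      (inj₁ uv∈) ≠e → inj₁ (subdivide-old es i uv∈ ≠e)
      (inj₂ vu∈) ≠e → inj₂ (subdivide-old es i vu∈ (≠e ∘ sameEdge-swapˡ))
  ; old⁻ = λ where
      (inj₁ uv∈) → let uv∈′ , ≠e = old uv∈ in inj₁ uv∈′ , ≠e
      (inj₂ vu∈) → let vu∈′ , ≠e = old vu∈ in inj₂ vu∈′ , ≠e ∘ sameEdge-swapˡ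
  ; new⁻ = new⁻
  ; no-loop = [ no-loop , no-loop ]′ }
  where
  old : ∀ {u v} → (suc u , suc v) ∈ subdivide es i → (u , v) ∈ es × ¬ SameEdge (u , v) (lookup es i)
  old uv∈ with subdivide⁻ es distinct i uv∈
  ... | inj₂ (inj₂ (_ , refl , f∈ , ≠e)) = f∈ , ≠e

  new⁻ : ∀ {u} → Adj (subdivide es i) (suc u) zero → _
  new⁻ (inj₁ e∈) with subdivide⁻ es distinct i e∈
  ... | inj₁ refl = inj₁ refl
  ... | inj₂ (inj₂ (_ , () , _))
  new⁻ (inj₂ e∈) with subdivide⁻ es distinct i e∈
  ... | inj₂ (inj₁ refl) = inj₂ refl
  ... | inj₂ (inj₂ (_ , () , _))

  no-loop : ¬ (zero , zero) ∈ subdivide es i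
  no-loop e∈ with subdivide⁻ es distinct i e∈
  ... | inj₂ (inj₂ (_ , () , _))

-- Labellings

data Compatible : Status → Status → Set where
  AB : Compatible A B
  BA : Compatible B A
  BC : Compatible B C
  CB : Compatible C B

beside-A : ∀ {s t} → Compatible s t → s ≡ A → t ≡ B
beside-A AB refl = refl

beside-C : ∀ {s t} → Compatible s t → s ≡ C → t ≡ B
beside-C CB refl = refl

beside-B : ∀ {s t} → Compatible s t → s ≡ B → t ≡ A ⊎ t ≡ C
beside-B BA refl = inj₁ refl
beside-B BC refl = inj₂ refl

_≟ₛ_ : (s t : Status) → Dec (s ≡ t)
A ≟ₛ A = yes refl
A ≟ₛ B = no λ ()
A ≟ₛ C = no λ ()
B ≟ₛ A = no λ ()
B ≟ₛ B = yes refl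
B ≟ₛ C = no λ ()
C ≟ₛ A = no λ ()
C ≟ₛ B = no λ ()
C ≟ₛ C = yes refl

differ : {st : Fin n → Status} {x y : Fin n} {s t : Status} → st x ≡ s → st y ≡ t → s ≢ t → x ≢ y
differ refl refl s≢t refl = s≢t refl

record Labelling (es : Edges n) (st : Fin n → Status) : Set where
  field
    compatible : ∀ {x y} → Adj es x y → Compatible (st x) (st y)
    uniqueA    : ∀ {b a a′} → Adj es b a → Adj es b a′ → st b ≡ B → st a ≡ A → st a′ ≡ A → a ≡ a′
    hasA       : ∀ {b} → st b ≡ B → ∃ λ a → Adj es b a × st a ≡ A
    hasC       : ∀ {b} → st b ≡ B → ∃ λ c → Adj es b c × st c ≡ C
    twoB       : ∀ {a} → st a ≡ A → ∃₂ λ b b′ → b ≢ b′ × Adj es a b × Adj es a b′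

  A⇒B : ∀ {x y} → Adj es x y → st x ≡ A → st y ≡ B
  A⇒B xy = beside-A (compatible xy)

  C⇒B : ∀ {x y} → Adj es x y → st x ≡ C → st y ≡ B
  C⇒B xy = beside-C (compatible xy)

  anotherB : ∀ {a} → st a ≡ A → ∀ v → ∃ λ b → b ≢ v × Adj es a b
  anotherB sa v with twoB sa
  ... | b , b′ , b≢b′ , ab , ab′ with b ≟ v
  ...   | no b≢v = b , b≢v , ab
  ...   | yes refl = b′ , b≢b′ ∘ sym , ab′

setA : (Fin n → Status) → Subset n
setA st = comprehension (λ x → st x ≟ₛ A)

setA-isolating : ∀ {st} → Labelling es st → Isolating es (setA st)
setA-isolating {es = es} {st} L u v uv∈ = dominated (compatible (inj₁ uv∈)) refl refl
  where
  open Labelling L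
  member : ∀ {x} → st x ≡ A → x ∈ₛ setA st
  member = ∈-comprehension⁺ (λ x → st x ≟ₛ A)

  dominatedB : ∀ {x} → st x ≡ B → InClosedNbhd es (setA st) x
  dominatedB sx = let a , xa , sa = hasA sx in inj₂ (a , member sa , xa)

  dominated : ∀ {s t} → Compatible s t → st u ≡ s → st v ≡ t →
              InClosedNbhd es (setA st) u ⊎ InClosedNbhd es (setA st) v
  dominated AB su sv = inj₁ (inj₁ (member su))
  dominated BA su sv = inj₁ (dominatedB su)
  dominated BC su sv = inj₁ (dominatedB su)
  dominated CB su sv = inj₂ (dominatedB sv)

-- Root the tree at the endpoint r of the subdivided edge rq with status B. Every A-vertex a has a child b
-- with a child c; these edges bc, one for each a, together with the extra edge rc (if q is an A-vertex) or zq
-- (if q is a C-vertex, z being the new vertex) have disjoint closed neighbourhoods: owner sends those of bc to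
-- a and those of the extra edge to r.
module LowerBound {n} {es : Edges n} {st : Fin n → Status} (L : Labelling es st)
  {r q : Fin n} (rq : Adj es r q) (sr : st r ≡ B) (R : Rooted es r)
  {gs : Edges (suc n)} (S : IsSubdivision es gs r q)
  {D : Subset (suc n)} (isoD : Isolating gs D) where

  open Labelling L
  open Rooted R
  open IsSubdivision S

  q≢r : q ≢ r
  q≢r refl with st r | compatible rq
  ... | _ | ()

  parent-q : parent q ≡ r
  parent-q = proj₂ (child rq (λ q≡pr → q≢r (trans q≡pr parent-root)))

  -- For a descending path a, b, c, the closed neighbourhood of bc consists of a, b, the
  -- `C`-children of b, and the `B`-children of c. Status and parent's status tell how many levels
  -- to climb to reach a. The third clause covers a `B`-vertex below a `C`-vertex and also `r`,
  -- which is its own parent.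
  ownerBy : Status → Status → Fin n → Fin n
  ownerBy A _ x = x
  ownerBy B A x = parent x
  ownerBy B _ x = parent (parent (parent x))
  ownerBy C _ x = parent (parent x)

  owner : Fin (suc n) → Fin n
  owner zero = r
  owner (suc x) = ownerBy (st x) (st (parent x)) x

  owner-A : ∀ {x} → st x ≡ A → owner (suc x) ≡ x
  owner-A sx rewrite sx = refl

  owner-C : ∀ {x} → st x ≡ C → owner (suc x) ≡ parent (parent x)
  owner-C sx rewrite sx = refl

  owner-BA : ∀ {x} → st x ≡ B → st (parent x) ≡ A → owner (suc x) ≡ parent x
  owner-BA sx spx rewrite sx | spx = refl

  owner-BC : ∀ {x} → st x ≡ B → st (parent x) ≡ C → owner (suc x) ≡ parent (parent (parent x))
  owner-BC sx spx rewrite sx | spx = refl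

  owner-BB : ∀ {x} → st x ≡ B → st (parent x) ≡ B → owner (suc x) ≡ parent (parent (parent x))
  owner-BB sx spx rewrite sx | spx = refl

  owner-r : owner (suc r) ≡ r
  owner-r = trans (owner-BB sr (trans (cong st parent-root) sr))
    (trans (cong (parent ∘ parent) parent-root) (trans (cong parent parent-root) parent-root))

  Owned : Fin n → Set
  Owned o = ∃ λ d → d ∈ₛ D × owner d ≡ o

  -- Serves both the edges bc (with `o` an `A`-vertex) and the extra edge (with `o ≡ r`). Old
  -- neighbours of `c` are its parent and its `B`-children; the new vertex, owned by `r`, is a
  -- neighbour only when `c ≡ q`.
  owned-near-C : ∀ {b c o} → st c ≡ C → parent c ≡ b → owner (suc b) ≡ o → parent b ≡ o →
                 (c ≡ q → o ≡ r) → c ≢ r → InClosedNbhd gs D (suc c) → Owned o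
  owned-near-C {b} {c} sc pc ob pb cq c≢r (inj₁ c∈) = suc c , c∈ , trans (owner-C sc) (trans (cong parent pc) pb)
  owned-near-C {b} {c} sc pc ob pb cq c≢r (inj₂ (zero , z∈ , cz)) =
    zero , z∈ , sym (cq ([ (λ c≡r → contradiction c≡r c≢r) , (λ c≡q → c≡q) ]′ (new⁻ cz)))
  owned-near-C {b} {c} sc pc ob pb cq c≢r (inj₂ (suc y , y∈ , cy)) with old⁻ cy
  ... | cy′ , _ with y ≟ parent c
  ...   | yes refl = suc y , y∈ , trans (cong (owner ∘ suc) pc) ob
  ...   | no y≢pc = suc y , y∈ ,
    trans (owner-BC (C⇒B cy′ sc) (trans (cong st py) sc)) (trans (cong (parent ∘ parent) py) (trans (cong parent pc) pb))
    where
    py : parent y ≡ c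
    py = proj₂ (child cy′ y≢pc)

  -- The hypotheses on neighbours say that an `A`-neighbour surviving the subdivision is `o` itself,
  -- and that `C`-neighbours are children. As `b ≢ q`, the new vertex is adjacent to `b` only when
  -- `b ≡ r`.
  owned-near-B : ∀ {b o} → st b ≡ B → owner (suc b) ≡ o → parent b ≡ o → (b ≡ r → o ≡ r) →
                 (∀ {y} → Adj gs (suc b) (suc y) → st y ≡ A → y ≡ o × st o ≡ A) →
                 (∀ {y} → Adj gs (suc b) (suc y) → st y ≡ C → y ≢ parent b) →
                 b ≢ q → InClosedNbhd gs D (suc b) → Owned o
  owned-near-B {b} sb ob pb br nbrA nbrC b≢q (inj₁ b∈) = suc b , b∈ , ob
  owned-near-B {b} sb ob pb br nbrA nbrC b≢q (inj₂ (zero , z∈ , bz)) =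
    zero , z∈ , sym (br ([ (λ b≡r → b≡r) , (λ b≡q → contradiction b≡q b≢q) ]′ (new⁻ bz)))
  owned-near-B {b} sb ob pb br nbrA nbrC b≢q (inj₂ (suc y , y∈ , by))
    with old⁻ by | beside-B (compatible (proj₁ (old⁻ by))) sb
  ... | _ | inj₁ sy = suc y , y∈ , trans (owner-A sy) (proj₁ (nbrA by sy))
  ... | by′ , _ | inj₂ sy =
    suc y , y∈ , trans (owner-C sy) (trans (cong parent (proj₂ (child by′ (nbrC by sy)))) pb)

  private
    A≢B : A ≢ B
    A≢B ()
    A≢C : A ≢ C
    A≢C ()
    B≢C : B ≢ C
    B≢C ()

  r-neither-C : ∀ {c} → st c ≡ C → c ≢ r
  r-neither-C sc = differ {st = st} sc sr (B≢C ∘ sym)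

  owned-A : ∀ {a} → st a ≡ A → Owned a
  owned-A {a} sa =
    -- Of the two neighbours of `a`, one is not its parent and hence is a child.
    let b , b≢pa , ab = anotherB sa (parent a)
        b≢r , pb = child ab b≢pa
        sb = A⇒B ab sa
        spb = trans (cong st pb) sa
        c , bc , sc = hasC sb
        c≢pb = differ {st = st} sc spb (A≢C ∘ sym)
        c≢r , pc = child bc c≢pb
        -- The parent of `q` is `r`, while the parent of `c` is `b`, which is not the root.
        c≢q = λ c≡q → b≢r (trans (sym pc) (trans (cong parent c≡q) parent-q))
        old = old⁺ bc λ where
          (inj₁ (b≡r , _)) → b≢r b≡r
          (inj₂ (_ , c≡r)) → c≢r c≡r
        b≢q = λ b≡q → A≢B (trans (sym spb) (trans (cong (st ∘ parent) b≡q) (trans (cong st parent-q) sr)))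
        ob = trans (owner-BA sb spb) pb
    in [ owned-near-B sb ob pb (λ b≡r → contradiction b≡r b≢r)
           (λ by sy → uniqueA (proj₁ (old⁻ by)) (adj-sym {es = es} ab) sb sy sa , sa)
           (λ by sy → differ {st = st} sy spb (A≢C ∘ sym)) b≢q
       , owned-near-C sc pc ob pb (λ c≡q → contradiction c≡q c≢q) c≢r
       ]′ (isolating-adj isoD old)

  owned-r-near-z : InClosedNbhd gs D zero → st q ≡ C → Owned r
  owned-r-near-z (inj₁ z∈) sq = zero , z∈ , refl
  owned-r-near-z (inj₂ (zero , z∈ , zz)) sq = contradiction zz no-loop
  owned-r-near-z (inj₂ (suc y , y∈ , zy)) sq with new⁻ (adj-sym {es = gs} zy)
  ... | inj₁ refl = suc r , y∈ , owner-r
  ... | inj₂ refl = suc q , y∈ , trans (owner-C sq) (trans (cong parent parent-q) parent-root)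

  owned-r : Owned r
  owned-r with beside-B (compatible rq) sr
  ... | inj₂ sq = [ owned-near-C sq parent-q owner-r parent-root (λ _ → refl) q≢r
                  , (λ z → owned-r-near-z z sq) ]′ (isolating-adj isoD new-right)
  ... | inj₁ sq =
    let c , rc , sc = hasC sr
        c≢r = r-neither-C sc
        c≢q = differ {st = st} sc sq (A≢C ∘ sym)
        pc = proj₂ (child rc (λ c≡pr → c≢r (trans c≡pr parent-root)))
        old = old⁺ rc λ where
          (inj₁ (_ , c≡q)) → c≢q c≡q
          (inj₂ (_ , c≡r)) → c≢r c≡r
    in [ owned-near-B sr owner-r parent-root (λ _ → refl)
           -- The only `A`-neighbour of `r` is `q`, and the subdivision has destroyed that
           -- adjacency.
           (λ ry sy → let ry′ , ≠rq = old⁻ ry in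
              contradiction (inj₁ (refl , uniqueA ry′ rq sr sy sq)) ≠rq)
           (λ ry sy y≡pr → r-neither-C sy (trans y≡pr parent-root)) (q≢r ∘ sym)
       , owned-near-C sc pc owner-r parent-root (λ _ → refl) c≢r
       ]′ (isolating-adj isoD old)

  -- Distinct owners come from distinct members of `D`. The member owned by `r` can be removed
  -- first, since `r` has status `B` and so is none of the `A`-vertices.
  ∣setA∣<∣D∣ : ∣ setA st ∣ < ∣ D ∣
  ∣setA∣<∣D∣ =
    let d , d∈ , od = owned-r in
    ℕ.≤-<-trans
      (∣∣-mono-injective (λ x y → owner y ≡ x) (λ p q → trans (sym p) q) (setA st) (D - d) λ {x} x∈ →
        let sx = ∈-comprehension⁻ (λ x → st x ≟ₛ A) x∈
            y , y∈ , oy = owned-A sx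
        in y , x∈p∧x≢y⇒x∈p-y y∈ (λ y≡d →
             differ {st = st} sx sr A≢B (trans (sym oy) (trans (cong owner y≡d) od))) , oy)
      (x∈p⇒∣p-x∣<∣p∣ d∈)

-- Criticality of labelled trees and transport along isomorphisms.

labelling⇒critical : ∀ {st} → IsTree n es → Labelling es st → (∃ λ x → st x ≡ A) → IotaCritical es
labelling⇒critical {es = es} {st} T@(_ , distinct , _) L (x , sx) = nonempty , critical
  where
  open Labelling L
  nonempty : es ≢ []
  nonempty refl with twoB sx
  ... | _ , _ , _ , inj₁ () , _
  ... | _ , _ , _ , inj₂ () , _

  -- Exactly one end of each edge has status `B`; the tree is rooted there.
  bound : ∀ {a b gs} → Adj es a b → IsSubdivision es gs a b → ∀ {s t} → Compatible s t → st a ≡ s → st b ≡ t →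
          ∀ {D} → Isolating gs D → ∣ setA st ∣ < ∣ D ∣
  bound {a} {b} ab S AB sa sb iso = LowerBound.∣setA∣<∣D∣ L (adj-sym {es = es} ab) sb (rooted T b) (subdivision-swap S) iso
  bound {a} {b} ab S BA sa sb iso = LowerBound.∣setA∣<∣D∣ L ab sa (rooted T a) S iso
  bound {a} {b} ab S BC sa sb iso = LowerBound.∣setA∣<∣D∣ L ab sa (rooted T a) S iso
  bound {a} {b} ab S CB sa sb iso = LowerBound.∣setA∣<∣D∣ L (adj-sym {es = es} ab) sb (rooted T b) (subdivision-swap S) iso

  critical : ∀ e k k′ → IsIota es k → IsIota (subdivide es e) k′ → k < k′
  critical e k k′ (_ , min) ((D , iso , refl) , _) = ℕ.≤-<-trans (min _ (setA-isolating L))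
    (bound (inj₁ (∈-lookup e)) (subdivide-isSubdivision es distinct e) (compatible (inj₁ (∈-lookup e))) refl refl iso)

labelling-transport : ∀ {st} ((f , _) : Isomorphic es fs) → Labelling fs st →
                      Labelling es (st ∘ Inverse.to f)
labelling-transport {es = es} {fs = fs} {st = st} (f , adj⇔) L = record
  { compatible = λ xy → compatible (forward xy)
  ; uniqueA = λ ba ba′ sb sa sa′ → to-injective (uniqueA (forward ba) (forward ba′) sb sa sa′)
  ; hasA = λ sb → let a , ba , sa = hasA sb in
      from a , backward ba , trans (cong st (to-from a)) sa
  ; hasC = λ sb → let c , bc , sc = hasC sb in
      from c , backward bc , trans (cong st (to-from c)) sc
  ; twoB = λ sa → let b , b′ , b≢b′ , ab , ab′ = twoB sa in
      from b , from b′ , (λ eq → b≢b′ (trans (sym (to-from b)) (trans (cong to eq) (to-from b′)))) ,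
      backward ab , backward ab′
  }
  where
  open Labelling L
  open Inverse f using (to; from)
  to-from : ∀ y → to (from y) ≡ y
  to-from = Inverse.strictlyInverseˡ f

  to-injective : ∀ {x y} → to x ≡ to y → x ≡ y
  to-injective {x} {y} eq =
    trans (sym (Inverse.strictlyInverseʳ f x)) (trans (cong from eq) (Inverse.strictlyInverseʳ f y))

  forward : ∀ {x y} → Adj es x y → Adj fs (to x) (to y)
  forward {x} {y} = Equivalence.to (adj⇔ x y)

  backward : ∀ {x y} → Adj fs (to x) y → Adj es x (from y)
  backward {x} {y} xy = Equivalence.from (adj⇔ x (from y)) (subst (Adj fs (to x)) (sym (to-from y)) xy)

-- Attaching a leaf

leaf : Fin n → Edges n → Edges (suc n)
leaf y es = (zero , suc y) ∷ liftEs es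

lift⁺ : ∀ {x y} → Adj es x y → Adj (liftEs es) (suc x) (suc y)
lift⁺ = Sum.map (∈-map⁺ liftE) (∈-map⁺ liftE)

lift⁻ : ∀ {x y} → Adj (liftEs es) (suc x) (suc y) → Adj es x y
lift⁻ = Sum.map unlift unlift
  where
  unlift : ∀ {x y} → (suc x , suc y) ∈ liftEs es → (x , y) ∈ es
  unlift e∈ with ∈-map⁻ liftE e∈
  ... | _ , e∈′ , refl = e∈′

lift-zero : ∀ {x} → ¬ Adj (liftEs es) zero x
lift-zero (inj₁ e∈) with ∈-map⁻ liftE e∈
... | _ , _ , ()
lift-zero (inj₂ e∈) with ∈-map⁻ liftE e∈
... | _ , _ , ()

leaf-new : ∀ {y} → Adj (leaf y es) zero (suc y)
leaf-new = inj₁ (here refl)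

leaf-old : ∀ {v x y} → Adj es x y → Adj (leaf v es) (suc x) (suc y)
leaf-old xy = Sum.map there there (lift⁺ xy)

leaf-new⁻ : ∀ {v x} → Adj (leaf v es) zero x → x ≡ suc v
leaf-new⁻ (inj₁ (here refl)) = refl
leaf-new⁻ {es = es} (inj₁ (there e∈)) = contradiction (inj₁ e∈) (lift-zero {es = es})
leaf-new⁻ {es = es} (inj₂ (there e∈)) = contradiction (inj₂ e∈) (lift-zero {es = es})

leaf-old⁻ : ∀ {v x y} → Adj (leaf v es) (suc x) (suc y) → Adj es x y
leaf-old⁻ (inj₁ (there e∈)) = lift⁻ (inj₁ e∈)
leaf-old⁻ (inj₂ (there e∈)) = lift⁻ (inj₂ e∈)

_⊆ₐ_ : Edges n → Edges n → Set
es ⊆ₐ fs = ∀ {x y} → Adj es x y → Adj fs x y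

⊆ₐ-edges : (∀ {x y} → (x , y) ∈ es → Adj fs x y) → es ⊆ₐ fs
⊆ₐ-edges sub (inj₁ xy∈) = sub xy∈
⊆ₐ-edges sub (inj₂ yx∈) = Sum.swap (sub yx∈)

-- The path added by the third operation, as four successive leaves; the latest leaf always has
-- index zero.
chain : Fin n → Edges n → Edges (4 + n)
chain x es = leaf zero (leaf zero (leaf zero (leaf x es)))

-- This list and `op3-edges` are those of the constructors of `Built`. They differ from iterated
-- leaves in order and orientation only, hence the inclusions both ways below.
op2-edges : Fin n → Edges n → Edges (2 + n)
op2-edges x es = (suc (suc x) , suc zero) ∷ (suc zero , zero) ∷ liftEs (liftEs es)

op3-edges : Fin n → Edges n → Edges (4 + n)
op3-edges x es = (suc (suc (suc (suc x))) , suc (suc (suc zero)))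
  ∷ (suc (suc (suc zero)) , suc (suc zero)) ∷ (suc (suc zero) , suc zero) ∷ (suc zero , zero)
  ∷ liftEs (liftEs (liftEs (liftEs es)))

op2⊆leaves : ∀ {x} {es : Edges n} → op2-edges x es ⊆ₐ leaf zero (leaf x es)
op2⊆leaves = ⊆ₐ-edges λ where
  (here refl) → inj₂ (there (here refl))
  (there (here refl)) → inj₂ (here refl)
  (there (there e∈)) → inj₁ (there (there e∈))

leaves⊆op2 : ∀ {x} {es : Edges n} → leaf zero (leaf x es) ⊆ₐ op2-edges x es
leaves⊆op2 = ⊆ₐ-edges λ where
  (here refl) → inj₂ (there (here refl))
  (there (here refl)) → inj₂ (here refl)
  (there (there e∈)) → inj₁ (there (there e∈))

op3⊆chain : ∀ {x} {es : Edges n} → op3-edges x es ⊆ₐ chain x es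
op3⊆chain = ⊆ₐ-edges λ where
  (here refl) → inj₂ (there (there (there (here refl))))
  (there (here refl)) → inj₂ (there (there (here refl)))
  (there (there (here refl))) → inj₂ (there (here refl))
  (there (there (there (here refl)))) → inj₂ (here refl)
  (there (there (there (there e∈)))) → inj₁ (there (there (there (there e∈))))

chain⊆op3 : ∀ {x} {es : Edges n} → chain x es ⊆ₐ op3-edges x es
chain⊆op3 = ⊆ₐ-edges λ where
  (here refl) → inj₂ (there (there (there (here refl))))
  (there (here refl)) → inj₂ (there (there (here refl)))
  (there (there (here refl))) → inj₂ (there (here refl))
  (there (there (there (here refl)))) → inj₂ (here refl)
  (there (there (there (there e∈)))) → inj₁ (there (there (there (there e∈))))

-- Labellings of built trees

-- These universal conditions hold after every single leaf. The existential ones, in `Satisfied`,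
-- can fail in the middle of an operation: a fresh `B`-leaf has at most one of its two required
-- kinds of neighbour. They are checked at the end.
record Partial (es : Edges n) (st : Fin n → Status) : Set where
  field
    compatible : ∀ {x y} → Adj es x y → Compatible (st x) (st y)
    uniqueA    : ∀ {b a a′} → Adj es b a → Adj es b a′ → st b ≡ B → st a ≡ A → st a′ ≡ A → a ≡ a′

Satisfied : Edges n → (Fin n → Status) → Fin n → Set
Satisfied es st x =
  (st x ≡ B → (∃ λ a → Adj es x a × st a ≡ A) × (∃ λ c → Adj es x c × st c ≡ C))
  × (st x ≡ A → ∃₂ λ b b′ → b ≢ b′ × Adj es x b × Adj es x b′)

complete : ∀ {st} → Partial es st → (∀ x → Satisfied es st x) → Labelling es st
complete P sat = record
  { compatible = compatible ; uniqueA = uniqueA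
  ; hasA = λ {b} sb → proj₁ (proj₁ (sat b) sb) ; hasC = λ {b} sb → proj₂ (proj₁ (sat b) sb)
  ; twoB = λ {a} → proj₂ (sat a) }
  where open Partial P

labelling⇒partial : ∀ {st} → Labelling es st → Partial es st
labelling⇒partial L = record { compatible = compatible ; uniqueA = uniqueA }
  where open Labelling L

labelling⇒satisfied : ∀ {st} → Labelling es st → ∀ x → Satisfied es st x
labelling⇒satisfied L x = (λ sb → hasA sb , hasC sb) , twoB
  where open Labelling L

labelling-≈ : ∀ {st} → es ⊆ₐ fs → fs ⊆ₐ es → Labelling es st → Labelling fs st
labelling-≈ es⊆fs fs⊆es L = record
  { compatible = compatible ∘ fs⊆es
  ; uniqueA = λ ba ba′ → uniqueA (fs⊆es ba) (fs⊆es ba′)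
  ; hasA = λ sb → let a , ba , sa = hasA sb in a , es⊆fs ba , sa
  ; hasC = λ sb → let c , bc , sc = hasC sb in c , es⊆fs bc , sc
  ; twoB = λ sa → let b , b′ , b≢b′ , ab , ab′ = twoB sa in b , b′ , b≢b′ , es⊆fs ab , es⊆fs ab′ }
  where open Labelling L

compatible-sym : ∀ {s t} → Compatible s t → Compatible t s
compatible-sym AB = BA
compatible-sym BA = AB
compatible-sym BC = CB
compatible-sym CB = BC

-- Only an `A`-leaf can spoil uniqueness, by giving `y` a second `A`-neighbour; the last hypothesis
-- excludes this.
leaf-partial : ∀ {st s y} → Partial es st → Compatible s (st y) →
               (s ≡ A → ∀ {a} → Adj es y a → st a ≢ A) → Partial (leaf y es) (s ∷ᵥ st)
leaf-partial {es = es} {st = st} {s} {y} P s~y noA = record { compatible = compatible′ ; uniqueA = uniqueA′ }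
  where
  open Partial P
  compatible′ : ∀ {u v} → Adj (leaf y es) u v → Compatible ((s ∷ᵥ st) u) ((s ∷ᵥ st) v)
  compatible′ {zero} zv with refl ← leaf-new⁻ {es = es} zv = s~y
  compatible′ {suc u} {zero} uz with refl ← leaf-new⁻ {es = es} (Sum.swap uz) = compatible-sym s~y
  compatible′ {suc u} {suc v} uv = compatible (leaf-old⁻ uv)

  uniqueA′ : ∀ {b a a′} → Adj (leaf y es) b a → Adj (leaf y es) b a′ →
             (s ∷ᵥ st) b ≡ B → (s ∷ᵥ st) a ≡ A → (s ∷ᵥ st) a′ ≡ A → a ≡ a′
  uniqueA′ {zero} ba ba′ _ _ _ = trans (leaf-new⁻ {es = es} ba) (sym (leaf-new⁻ {es = es} ba′))
  uniqueA′ {suc b} {zero} {zero} _ _ _ _ _ = refl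
  uniqueA′ {suc b} {zero} {suc a′} bz ba′ _ s≡A sa′ with refl ← leaf-new⁻ {es = es} (Sum.swap bz) =
    contradiction sa′ (noA s≡A (leaf-old⁻ ba′))
  uniqueA′ {suc b} {suc a} {zero} ba bz _ sa s≡A with refl ← leaf-new⁻ {es = es} (Sum.swap bz) =
    contradiction sa (noA s≡A (leaf-old⁻ ba))
  uniqueA′ {suc b} {suc a} {suc a′} ba ba′ sb sa sa′ = cong suc (uniqueA (leaf-old⁻ ba) (leaf-old⁻ ba′) sb sa sa′)

leaf-satisfied : ∀ {st s x y} → Satisfied es st x → Satisfied (leaf y es) (s ∷ᵥ st) (suc x)
leaf-satisfied (satB , satA) =
  (λ sb → let (a , xa , sa) , (c , xc , sc) = satB sb in (suc a , leaf-old xa , sa) , (suc c , leaf-old xc , sc)) ,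
  (λ sa → let b , b′ , b≢b′ , xb , xb′ = satA sa in
    suc b , suc b′ , b≢b′ ∘ suc-injective , leaf-old xb , leaf-old xb′)

compatible-with : ∀ {s t t′} → t′ ≡ t → Compatible s t → Compatible s t′
compatible-with refl c = c

chain-labelling : ∀ {st x} → Partial es st → (∀ y → Satisfied es st y) → st x ≡ C →
                  Labelling (chain x es) (C ∷ᵥ B ∷ᵥ A ∷ᵥ B ∷ᵥ st)
chain-labelling {es = es} {st} {x} P sat sx = complete partial satisfied
  where
  partial : Partial (chain x es) (C ∷ᵥ B ∷ᵥ A ∷ᵥ B ∷ᵥ st)
  partial = leaf-partial
    (leaf-partial
      (leaf-partial
        (leaf-partial P (compatible-with sx BC) λ ())
        -- At this stage the `B`-leaf has `x` as its sole neighbour, and `x` has status `C`.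
        AB (λ _ ua → subst (λ a → (B ∷ᵥ st) a ≢ A) (sym (leaf-new⁻ {es = es} ua)) λ sx≡A →
              contradiction (trans (sym sx) sx≡A) λ ()))
      BA λ ())
    CB λ ()

  satisfied : ∀ y → Satisfied (chain x es) (C ∷ᵥ B ∷ᵥ A ∷ᵥ B ∷ᵥ st) y
  satisfied zero = (λ ()) , λ ()
  satisfied (suc zero) =
    (λ _ → (suc (suc zero) , inj₁ (there (here refl)) , refl) , (zero , inj₂ (here refl) , refl)) , λ ()
  satisfied (suc (suc zero)) = (λ ()) ,
    λ _ → suc zero , suc (suc (suc zero)) , (λ ()) , inj₂ (there (here refl)) , inj₁ (there (there (here refl)))
  satisfied (suc (suc (suc zero))) =
    (λ _ → (suc (suc zero) , inj₂ (there (there (here refl))) , refl) ,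
           (suc (suc (suc (suc x))) , inj₁ (there (there (there (here refl)))) , sx)) , λ ()
  satisfied (suc (suc (suc (suc y)))) =
    leaf-satisfied (leaf-satisfied (leaf-satisfied (leaf-satisfied {es = es} {x = y} (sat y))))

built-labelling : ∀ {st} → Built n es st → Labelling es st
-- `P5-edges` is definitionally the chain attached to a single vertex of status `C`.
built-labelling base = chain-labelling {es = []} {st = C ∷ᵥ λ ()} {x = zero}
  (record { compatible = λ where
              (inj₁ ())
              (inj₂ ())
          ; uniqueA = λ where
              (inj₁ ())
              (inj₂ ()) })
  (λ where zero → (λ ()) , λ ()) refl
built-labelling (op1 {es = es} {st} built y sy) = complete
  (leaf-partial (labelling⇒partial L) (compatible-with sy CB) λ ())
  λ where
    zero → (λ ()) , λ ()
    (suc x) → leaf-satisfied {es = es} {x = x} (labelling⇒satisfied L x)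
  where L = built-labelling built
built-labelling (op2 {es = es} {st} built x sx) = labelling-≈ leaves⊆op2 op2⊆leaves (complete
  (leaf-partial (leaf-partial (labelling⇒partial L) (compatible-with sx BA) λ ()) CB λ ())
  λ where
    zero → (λ ()) , λ ()
    (suc zero) → (λ _ → (suc (suc x) , inj₁ (there (here refl)) , sx) , (zero , inj₂ (here refl) , refl)) , λ ()
    (suc (suc y)) → leaf-satisfied (leaf-satisfied {es = es} {x = y} (labelling⇒satisfied L y)))
  where L = built-labelling built
built-labelling (op3 built x sx) = labelling-≈ chain⊆op3 op3⊆chain
  (chain-labelling (labelling⇒partial L) (labelling⇒satisfied L) sx)
  where L = built-labelling built

built-A : ∀ {st} → Built n es st → ∃ λ x → st x ≡ A
built-A base = suc (suc zero) , refl
built-A (op1 built _ _) = let x , sx = built-A built in suc x , sx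
built-A (op2 built _ _) = let x , sx = built-A built in suc (suc x) , sx
built-A (op3 built _ _) = let x , sx = built-A built in suc (suc (suc (suc x))) , sx

family⇒critical : IsTree n es → InFamily es → IotaCritical es
family⇒critical T (_ , _ , st , built , iso@(f , _)) =
  let x , sx = built-A built in
  labelling⇒critical T (labelling-transport iso (built-labelling built))
    (Inverse.from f x , trans (cong st (Inverse.strictlyInverseˡ f x)) sx)

-- The labelling given by a minimum isolating set

-- Domination that survives the subdivision of e.
Kept : Edges n → Edge n → Subset n → Fin n → Set
Kept es e D x = (x ∈ₛ D) ⊎ (∃ λ y → y ∈ₛ D × Adj es x y × ¬ SameEdge (x , y) e)

-- The new vertex stays outside the set. Its two edges are covered either by `x`, which dominates
-- the new vertex, or by their old ends, both still dominated.
isolating-subdivision : ∀ {x y D} → IsSubdivision es gs x y →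
  (∀ {u v} → Adj es u v → ¬ SameEdge (u , v) (x , y) → Kept es (x , y) D u ⊎ Kept es (x , y) D v) →
  x ∈ₛ D ⊎ (Kept es (x , y) D x × Kept es (x , y) D y) →
  Isolating gs (outside ∷ D)
isolating-subdivision {es = es} {gs = gs} {x} {y} {D} S old new = isolating
  where
  open IsSubdivision S
  kept : ∀ {u} → Kept es (x , y) D u → InClosedNbhd gs (outside ∷ D) (suc u)
  kept (inj₁ u∈) = inj₁ (there u∈)
  kept (inj₂ (w , w∈ , uw , ≠xy)) = inj₂ (suc w , there w∈ , old⁺ uw ≠xy)

  endpoint : ∀ {u} → u ≡ x ⊎ u ≡ y → InClosedNbhd gs (outside ∷ D) zero ⊎ InClosedNbhd gs (outside ∷ D) (suc u)
  endpoint u≡ = [ (λ x∈ → inj₁ (inj₂ (suc x , there x∈ , Sum.swap new-left)))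
                , (λ (kx , ky) → inj₂ ([ (λ where refl → kept kx) , (λ where refl → kept ky) ]′ u≡)) ]′ new

  isolating : Isolating gs (outside ∷ D)
  isolating zero zero e∈ = contradiction (inj₁ e∈) no-loop
  isolating zero (suc v) e∈ = endpoint (new⁻ (inj₂ e∈))
  isolating (suc u) zero e∈ = Sum.swap (endpoint (new⁻ (inj₁ e∈)))
  isolating (suc u) (suc v) e∈ = let uv , ≠xy = old⁻ (inj₁ e∈) in Sum.map kept kept (old uv ≠xy)

-- With ι of the subdivision supplied by `iota-exists`, criticality becomes a bound on all isolating
-- sets of the subdivided tree, for an edge taken in either orientation.
subdivision-raises : IsTree n es → IotaCritical es → ∀ {k} → IsIota es k → ∀ {x y} → Adj es x y →
  ∃ λ gs → IsSubdivision es gs x y × (∀ D → Isolating gs D → k < ∣ D ∣)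
subdivision-raises {es = es} (_ , distinct , _) (_ , critical) ι xy =
  let i , xy≈ = adj-index xy
      k′ , ι′ = iota-exists (subdivide es i)
  in subdivide es i , orient xy≈ (subdivide-isSubdivision es distinct i) ,
     λ D iso → ℕ.<-≤-trans (critical i _ k′ ι ι′) (proj₂ ι′ D iso)
  where
  orient : ∀ {x y a b gs} → SameEdge (x , y) (a , b) → IsSubdivision es gs a b → IsSubdivision es gs x y
  orient (inj₁ (refl , refl)) S = S
  orient (inj₂ (refl , refl)) S = subdivision-swap S

module MinimumSet {n} {es : Edges n} (T : IsTree n es) (critical : IotaCritical es)
  (D : Subset n) (isoD : Isolating es D) (ι : IsIota es ∣ D ∣) where

  -- The form in which criticality is applied: each structural property of `D` follows because its
  -- failure would give a set `D′` that is no larger and isolates a subdivision.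
  stuck : ∀ {x y D′} → Adj es x y → ∣ D′ ∣ ≤ ∣ D ∣ →
    (∀ {u v} → Adj es u v → ¬ SameEdge (u , v) (x , y) → Kept es (x , y) D′ u ⊎ Kept es (x , y) D′ v) →
    ¬ (x ∈ₛ D′ ⊎ (Kept es (x , y) D′ x × Kept es (x , y) D′ y))
  stuck xy D′≤D old new =
    let gs , S , raised = subdivision-raises T critical ι xy
    in ℕ.<⇒≱ (raised _ (isolating-subdivision S old new)) D′≤D

  data View (x : Fin n) : Status → Set where
    inA : x ∈ₛ D → View x A
    inB : x ∉ₛ D → ∀ {y} → y ∈ₛ D → Adj es x y → View x B
    inC : x ∉ₛ D → (∀ {y} → y ∈ₛ D → ¬ Adj es x y) → View x C

  classify : ∀ x → ∃ (View x)
  classify x with x ∈? D | any? (λ y → y ∈? D ×-dec adj? es x y)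
  ... | yes x∈ | _ = A , inA x∈
  ... | no x∉ | yes (y , y∈ , xy) = B , inB x∉ y∈ xy
  ... | no x∉ | no none = C , inC x∉ λ y∈ xy → none (_ , y∈ , xy)

  label : Fin n → Status
  label x = proj₁ (classify x)

  view : ∀ x → View x (label x)
  view x = proj₂ (classify x)

  view-A : ∀ {x} → label x ≡ A → x ∈ₛ D
  view-A {x} eq with subst (View x) eq (view x)
  ... | inA x∈ = x∈

  view-B : ∀ {x} → label x ≡ B → x ∉ₛ D × ∃ λ y → y ∈ₛ D × Adj es x y
  view-B {x} eq with subst (View x) eq (view x)
  ... | inB x∉ y∈ xy = x∉ , _ , y∈ , xy

  label-A : ∀ {x} → x ∈ₛ D → label x ≡ A
  label-A {x} x∈ with label x | view x
  ... | _ | inA _ = refl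
  ... | _ | inB x∉ _ _ = contradiction x∈ x∉
  ... | _ | inC x∉ _ = contradiction x∈ x∉

  irreflexive : ∀ {x} → ¬ Adj es x x
  irreflexive = [ (λ e∈ → proj₁ T _ _ e∈ refl) , (λ e∈ → proj₁ T _ _ e∈ refl) ]′

  -- Subdividing an edge inside `D` costs no domination: the only vertices dominated along it are
  -- its own ends, which belong to `D`.
  D-independent : ∀ {x y} → x ∈ₛ D → y ∈ₛ D → ¬ Adj es x y
  D-independent {x} {y} x∈ y∈ xy =
    stuck xy ℕ.≤-refl (λ uv _ → Sum.map kept kept (isolating-adj isoD uv)) (inj₁ x∈)
    where
    kept : ∀ {u} → InClosedNbhd es D u → Kept es (x , y) D u
    kept (inj₁ u∈) = inj₁ u∈
    kept {u} (inj₂ (w , w∈ , uw)) with u ∈? D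
    ... | yes u∈ = inj₁ u∈
    ... | no u∉ = inj₂ (w , w∈ , uw , λ where
      (inj₁ (refl , _)) → u∉ x∈
      (inj₂ (refl , _)) → u∉ y∈)

  -- No vertex is dominated along an edge with both ends outside `D`, so subdividing it leaves all
  -- domination intact, including that of both ends.
  B-independent : ∀ {x y} → x ∉ₛ D → y ∉ₛ D → InClosedNbhd es D x → InClosedNbhd es D y → ¬ Adj es x y
  B-independent {x} {y} x∉ y∉ dx dy xy =
    stuck xy ℕ.≤-refl (λ uv _ → Sum.map kept kept (isolating-adj isoD uv)) (inj₂ (kept dx , kept dy))
    where
    kept : ∀ {u} → InClosedNbhd es D u → Kept es (x , y) D u
    kept (inj₁ u∈) = inj₁ u∈
    kept (inj₂ (w , w∈ , uw)) = inj₂ (w , w∈ , uw , λ where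
      (inj₁ (_ , refl)) → y∉ w∈
      (inj₂ (_ , refl)) → x∉ w∈)

  -- If `u ≢ u′`, subdivide `u v`: the new vertex is dominated by `u`, and `v` remains dominated by
  -- `u′`.
  B-private : ∀ {v u u′} → v ∉ₛ D → u ∈ₛ D → u′ ∈ₛ D → Adj es v u → Adj es v u′ → u ≡ u′
  B-private {v} {u} {u′} v∉ u∈ u′∈ vu vu′ with u ≟ u′
  ... | yes u≡u′ = u≡u′
  ... | no u≢u′ = contradiction (inj₁ u∈)
    (stuck {u} {v} (Sum.swap vu) ℕ.≤-refl λ wz _ → Sum.map kept kept (isolating-adj isoD wz))
    where
    kept : ∀ {w} → InClosedNbhd es D w → Kept es (u , v) D w
    kept (inj₁ w∈) = inj₁ w∈
    kept {w} (inj₂ (z , z∈ , wz)) with w ≟ v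
    ... | yes refl = inj₂ (u′ , u′∈ , vu′ , λ where
      (inj₁ (refl , _)) → v∉ u∈
      (inj₂ (_ , refl)) → u≢u′ refl)
    ... | no w≢v = inj₂ (z , z∈ , wz , λ where
      (inj₁ (_ , refl)) → v∉ z∈
      (inj₂ (refl , _)) → w≢v refl)

  -- Subdividing `u v` can cost only `v` its domination. Were all neighbours of `v` dominated, the
  -- edges at `v` would still be covered from their other ends.
  B-undominated : ∀ {v u} → v ∉ₛ D → u ∈ₛ D → Adj es v u → ¬ (∀ {x} → Adj es v x → InClosedNbhd es D x)
  B-undominated {v} {u} v∉ u∈ vu all = stuck (Sum.swap vu) ℕ.≤-refl old (inj₁ u∈)
    where
    kept : ∀ {w} → w ≢ v → InClosedNbhd es D w → Kept es (u , v) D w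
    kept w≢v (inj₁ w∈) = inj₁ w∈
    kept w≢v (inj₂ (z , z∈ , wz)) = inj₂ (z , z∈ , wz , λ where
      (inj₁ (_ , refl)) → v∉ z∈
      (inj₂ (refl , _)) → w≢v refl)

    old : ∀ {x y} → Adj es x y → ¬ SameEdge (x , y) (u , v) → Kept es (u , v) D x ⊎ Kept es (u , v) D y
    old {x} {y} xy _ with x ≟ v | y ≟ v
    ... | yes refl | yes refl = contradiction xy irreflexive
    ... | yes refl | no y≢v = inj₂ (kept y≢v (all xy))
    ... | no x≢v | yes refl = inj₁ (kept x≢v (all (Sum.swap xy)))
    ... | no x≢v | no y≢v = Sum.map (kept x≢v) (kept y≢v) (isolating-adj isoD xy)

  -- Otherwise the set obtained from D by replacing a with b is isolating after subdividing ab.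
  A-not-leaf : ∀ {a b} → a ∈ₛ D → Adj es a b → ¬ (∀ {x} → Adj es a x → x ≡ b)
  A-not-leaf {a} {b} a∈ ab only = stuck (Sum.swap ab) D′≤D old (inj₁ (member (inj₁ refl)))
    where
    InD′ : Fin n → Set
    InD′ x = x ≡ b ⊎ (x ∈ₛ D × x ≢ a)

    inD′? : ∀ x → Dec (InD′ x)
    inD′? x = x ≟ b ⊎-dec (x ∈? D ×-dec ¬? (x ≟ a))

    D′ : Subset n
    D′ = comprehension inD′?

    member : ∀ {x} → InD′ x → x ∈ₛ D′
    member = ∈-comprehension⁺ inD′?

    Moves : Fin n → Fin n → Set
    Moves x y = (x ≡ b × y ≡ a) ⊎ (x ≢ a × x ≡ y)

    D′≤D : ∣ D′ ∣ ≤ ∣ D ∣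
    D′≤D = ∣∣-mono-injective Moves
      (λ where
        (inj₁ (refl , refl)) (inj₁ (refl , _)) → refl
        (inj₁ (refl , refl)) (inj₂ (x≢a , refl)) → contradiction refl x≢a
        (inj₂ (x≢a , refl)) (inj₁ (refl , refl)) → contradiction refl x≢a
        (inj₂ (_ , refl)) (inj₂ (_ , refl)) → refl)
      D′ D λ x∈ → [ (λ x≡b → a , a∈ , inj₁ (x≡b , refl))
                  , (λ (x∈D , x≢a) → _ , x∈D , inj₂ (x≢a , refl)) ]′ (∈-comprehension⁻ inD′? x∈)

    kept : ∀ {u} → u ≢ a → InClosedNbhd es D u → Kept es (b , a) D′ u
    kept {u} u≢a du with u ≟ b
    ... | yes refl = inj₁ (member (inj₁ refl))
    kept {u} u≢a (inj₁ u∈) | no u≢b = inj₁ (member (inj₂ (u∈ , u≢a)))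
    kept {u} u≢a (inj₂ (z , z∈ , uz)) | no u≢b with z ≟ a
    ... | yes refl = contradiction (only (Sum.swap uz)) u≢b
    ... | no z≢a = inj₂ (z , member (inj₂ (z∈ , z≢a)) , uz , λ where
      (inj₁ (u≡b , _)) → u≢b u≡b
      (inj₂ (u≡a , _)) → u≢a u≡a)

    old : ∀ {u v} → Adj es u v → ¬ SameEdge (u , v) (b , a) → Kept es (b , a) D′ u ⊎ Kept es (b , a) D′ v
    old {u} {v} uv ≠ba with u ≟ a | v ≟ a
    ... | yes refl | _ = contradiction (inj₂ (refl , only uv)) ≠ba
    ... | _ | yes refl = contradiction (inj₁ (only (Sum.swap uv) , refl)) ≠ba
    ... | no u≢a | no v≢a = Sum.map (kept u≢a) (kept v≢a) (isolating-adj isoD uv)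

  compatible : ∀ {x y} → Adj es x y → Compatible (label x) (label y)
  compatible {x} {y} xy = go (view x) (view y)
    where
    undominated : ∀ {z} → z ∉ₛ D → (∀ {y} → y ∈ₛ D → ¬ Adj es z y) → ¬ InClosedNbhd es D z
    undominated z∉ none (inj₁ z∈) = z∉ z∈
    undominated z∉ none (inj₂ (_ , w∈ , zw)) = none w∈ zw

    go : ∀ {s t} → View x s → View y t → Compatible s t
    go (inA x∈) (inA y∈) = contradiction xy (D-independent x∈ y∈)
    go (inA x∈) (inB _ _ _) = AB
    go (inA x∈) (inC _ none) = contradiction (Sum.swap xy) (none x∈)
    go (inB _ _ _) (inA _) = BA
    go (inB x∉ u∈ xu) (inB y∉ v∈ yv) =
      contradiction xy (B-independent x∉ y∉ (inj₂ (_ , u∈ , xu)) (inj₂ (_ , v∈ , yv)))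
    go (inB _ _ _) (inC _ _) = BC
    go (inC _ none) (inA y∈) = contradiction xy (none y∈)
    go (inC _ _) (inB _ _ _) = CB
    go (inC x∉ nonex) (inC y∉ noney) =
      contradiction (isolating-adj isoD xy) [ undominated x∉ nonex , undominated y∉ noney ]′

  hasC : ∀ {b} → label b ≡ B → ∃ λ c → Adj es b c × label c ≡ C
  hasC {b} sb with any? (λ c → adj? es b c ×-dec (label c ≟ₛ C))
  ... | yes found = found
  ... | no none = let b∉ , a , a∈ , ba = view-B sb in
    contradiction (λ {x} → dominated {x}) (B-undominated b∉ a∈ ba)
    where
    dominated : ∀ {x} → Adj es b x → InClosedNbhd es D x
    dominated {x} bx with beside-B (compatible bx) sb
    ... | inj₁ sx = inj₁ (view-A sx)
    ... | inj₂ sx = contradiction (x , bx , sx) none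

  neighbour : ∀ x → ∃ (Adj es x)
  neighbour x = other es refl
    where
    first : ∀ {y} → x ≢ y → Star (Adj es) x y → ∃ (Adj es x)
    first x≢x ε = contradiction refl x≢x
    first _ (xy ◅ _) = _ , xy

    other : ∀ fs → es ≡ fs → ∃ (Adj es x)
    other [] es≡[] = contradiction es≡[] (proj₁ critical)
    other ((u , v) ∷ _) refl with x ≟ u
    ... | yes refl = v , inj₁ (here refl)
    ... | no x≢u = first x≢u (proj₁ (proj₂ (proj₂ T)) x u)

  twoB : ∀ {a} → label a ≡ A → ∃₂ λ b b′ → b ≢ b′ × Adj es a b × Adj es a b′
  twoB {a} sa with neighbour a
  ... | b , ab with any? (λ b′ → ¬? (b ≟ b′) ×-dec adj? es a b′)
  ...   | yes (b′ , b≢b′ , ab′) = b , b′ , b≢b′ , ab , ab′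
  ...   | no none = contradiction (λ {x} → only {x}) (A-not-leaf (view-A sa) ab)
    where
    only : ∀ {x} → Adj es a x → x ≡ b
    only {x} ax with b ≟ x
    ... | yes refl = refl
    ... | no b≢x = contradiction (x , b≢x , ax) none

  labelling : Labelling es label
  labelling = record
    { compatible = compatible
    ; uniqueA = λ ba ba′ sb sa sa′ → B-private (proj₁ (view-B sb)) (view-A sa) (view-A sa′) ba ba′
    ; hasA = λ sb → let _ , a , a∈ , ba = view-B sb in a , ba , label-A a∈
    ; hasC = hasC
    ; twoB = twoB }

critical⇒labelling : IsTree n es → IotaCritical es → ∃ (Labelling es)
critical⇒labelling {es = es} T critical with iota-exists es
... | _ , ι@((D , isoD , refl) , _) = _ , MinimumSet.labelling T critical D isoD ι

-- Growing a built tree inside a labelled tree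

module Growth {n} {es : Edges n} {lab : Fin n → Status} (L : Labelling es lab)
  {r : Fin n} (R : Rooted es r) where

  open Labelling L
  open Rooted R

  -- The last two fields make the image closed under parents, with the parent edges present in `fs`.
  -- Hence children of vertices outside the image lie outside, and an embedding that is onto
  -- reflects adjacency.
  record Embedding {m} (fs : Edges m) (st : Vector Status m) (φ : Vector (Fin n) m) : Set where
    field
      injective : ∀ {x y} → φ x ≡ φ y → x ≡ y
      hom       : ∀ {x y} → Adj fs x y → Adj es (φ x) (φ y)
      status    : ∀ x → st x ≡ lab (φ x)
      root-in   : ∃ λ x → φ x ≡ r
      parent-in : ∀ x → φ x ≡ r ⊎ (∃ λ y → φ y ≡ parent (φ x) × Adj fs x y)

  embedding-≈ : ∀ {fs fs′ : Edges m} {st φ} → fs ⊆ₐ fs′ → fs′ ⊆ₐ fs →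
                Embedding fs st φ → Embedding fs′ st φ
  embedding-≈ fs⊆fs′ fs′⊆fs E = record
    { injective = injective ; hom = hom ∘ fs′⊆fs ; status = status ; root-in = root-in
    ; parent-in = λ x → Sum.map₂ (λ (y , φy , xy) → y , φy , fs⊆fs′ xy) (parent-in x) }
    where open Embedding E

  Fresh : Vector (Fin n) m → Fin n → Set
  Fresh φ v = ∀ x → φ x ≢ v

  fresh≢root : ∀ {fs : Edges m} {st φ v} → Embedding fs st φ → Fresh φ v → v ≢ r
  fresh≢root E fresh refl = let x , φx≡r = Embedding.root-in E in fresh x φx≡r

  attach : ∀ {fs : Edges m} {st φ y v s} → Embedding fs st φ → Fresh φ v → parent v ≡ φ y → s ≡ lab v →
           Embedding (leaf y fs) (s ∷ᵥ st) (v ∷ᵥ φ)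
  attach {fs = fs} {st} {φ} {y} {v} {s} E fresh pv sv = record
    { injective = injective′ ; hom = hom′
    ; status = λ where
        zero → sv
        (suc x) → status x
    ; root-in = let x , φx≡r = root-in in suc x , φx≡r
    ; parent-in = λ where
        zero → inj₂ (suc y , sym pv , leaf-new {es = fs})
        (suc x) → Sum.map₂ (λ (z , φz , xz) → suc z , φz , leaf-old xz) (parent-in x) }
    where
    open Embedding E
    v-y : Adj es v (φ y)
    v-y = subst (Adj es v) pv (adj-parent (fresh≢root E fresh))

    injective′ : ∀ {x z} → (v ∷ᵥ φ) x ≡ (v ∷ᵥ φ) z → x ≡ z
    injective′ {zero} {zero} _ = refl
    injective′ {zero} {suc z} eq = contradiction (sym eq) (fresh z)
    injective′ {suc x} {zero} eq = contradiction eq (fresh x)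
    injective′ {suc x} {suc z} eq = cong suc (injective eq)

    hom′ : ∀ {x z} → Adj (leaf y fs) x z → Adj es ((v ∷ᵥ φ) x) ((v ∷ᵥ φ) z)
    hom′ {zero} vz with refl ← leaf-new⁻ {es = fs} vz = v-y
    hom′ {suc x} {zero} xv with refl ← leaf-new⁻ {es = fs} (Sum.swap xv) = Sum.swap v-y
    hom′ {suc x} {suc z} xz = hom (leaf-old⁻ xz)

  -- If `w` were in the old image, so would be its parent `v`; and `w` differs from `v` by depth.
  fresh-child : ∀ {fs : Edges m} {st φ v w} → Embedding fs st φ → Fresh φ v → w ≢ r → parent w ≡ v →
                Fresh (v ∷ᵥ φ) w
  fresh-child E fresh w≢r pw zero refl =
    ℕ.<-irrefl (cong depth pw) (depth-parent w≢r)
  fresh-child E fresh w≢r pw (suc x) refl with Embedding.parent-in E x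
  ... | inj₁ φx≡r = w≢r φx≡r
  ... | inj₂ (y , φy , _) = fresh y (trans φy pw)

  child-≢ : ∀ {v w s t} → Adj es v w → lab w ≡ s → lab (parent v) ≡ t → s ≢ t → w ≢ r × parent w ≡ v
  child-≢ vw sw spv s≢t = child vw (differ {st = lab} sw spv s≢t)

  -- The labelling supplies the rest of a descending path with statuses `B`, `A`, `B`, `C`, starting
  -- at `u`. Each next vertex is a child because it is distinct from the parent of the current one.
  attach-chain : ∀ {fs : Edges m} {st φ y u} → Embedding fs st φ → lab (φ y) ≡ C → Fresh φ u → parent u ≡ φ y →
                 ∃ (Embedding (chain y fs) (C ∷ᵥ B ∷ᵥ A ∷ᵥ B ∷ᵥ st))
  attach-chain {y = y} {u} E sy fresh pu =
    let spu = trans (cong lab pu) sy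
        su = C⇒B (Sum.swap (adj-parent (fresh≢root E fresh))) spu
        E₁ = attach {y = y} E fresh pu (sym su)
        v , uv , sv = hasA su
        v≢r , pv = child-≢ uv sv spu λ ()
        fresh₁ = fresh-child E fresh v≢r pv
        E₂ = attach {y = zero} E₁ fresh₁ pv (sym sv)
        -- An `A`-vertex has a neighbour besides its parent `u`.
        w , w≢u , vw = anotherB sv u
        sw = A⇒B vw sv
        w≢r , pw = child vw (λ w≡pv → w≢u (trans w≡pv pv))
        fresh₂ = fresh-child E₁ fresh₁ w≢r pw
        E₃ = attach {y = zero} E₂ fresh₂ pw (sym sw)
        z , wz , sz = hasC sw
        z≢r , pz = child-≢ wz sz (trans (cong lab pw) sv) λ ()
    in _ , attach {y = zero} E₃ (fresh-child E₂ fresh₂ z≢r pz) pz (sym sz)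

  record Grown (m : ℕ) : Set where
    constructor grown
    field
      {edges}   : Edges m
      {st}      : Vector Status m
      {φ}       : Vector (Fin n) m
      built     : Built m edges st
      embedding : Embedding edges st φ

  seed : ∀ {u} → lab r ≡ C → Adj es r u → Grown 5
  seed {u} sr ru =
    let u≢r , pu = child-≢ ru (C⇒B ru sr) (trans (cong lab parent-root) sr) λ ()
    in grown base (proj₂ (attach-chain {y = zero} point sr (λ where
         zero → u≢r ∘ sym
         (suc ())) pu))
    where
    Fin1-trivial : (x y : Fin 1) → x ≡ y
    Fin1-trivial zero zero = refl

    point : Embedding [] (C ∷ᵥ λ ()) (r ∷ᵥ λ ())
    point = record
      { injective = λ {x} {y} _ → Fin1-trivial x y
      ; hom = λ where
          (inj₁ ())
          (inj₂ ())
      ; status = λ where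
          zero → sym sr
          (suc ())
      ; root-in = zero , refl
      ; parent-in = λ where
          zero → inj₁ refl
          (suc ()) }

  -- The statuses of `φ y` and `v` select the operation. The result has `suc k` further vertices, so
  -- growth is strict.
  step : ∀ {fs : Edges m} {st φ v y} → Built m fs st → Embedding fs st φ → Fresh φ v → parent v ≡ φ y →
         ∃ λ k → Grown (suc k + m)
  step {m = m} {fs = fs} {st} {φ} {v} {y} built E fresh pv = go (compatible y-v) refl refl
    where
    open Embedding E
    y-v : Adj es (φ y) v
    y-v = Sum.swap (subst (Adj es v) pv (adj-parent (fresh≢root E fresh)))

    status-y : ∀ {s} → lab (φ y) ≡ s → st y ≡ s
    status-y = trans (status y)

    go : ∀ {s t} → Compatible s t → lab (φ y) ≡ s → lab v ≡ t → ∃ λ k → Grown (suc k + m)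
    go AB sy sv =
      let c , vc , sc = hasC sv
          c≢r , pc = child-≢ vc sc (trans (cong lab pv) sy) λ ()
          E₁ = attach {y = y} E fresh pv (sym sv)
          E₂ = attach {y = zero} E₁ (fresh-child E fresh c≢r pc) pc (sym sc)
      in 1 , grown (op2 built y (status-y sy)) (embedding-≈ leaves⊆op2 op2⊆leaves E₂)
    -- The built tree is itself labelled, so `y` already has an `A`-neighbour in it; uniqueness
    -- identifies its image with `v`, which is fresh.
    go BA sy sv =
      let a , ya , sa = Labelling.hasA (built-labelling built) (status-y sy)
      in contradiction (uniqueA (hom ya) y-v sy (trans (sym (status a)) sa) sv) (fresh a)
    go BC sy sv = 0 , grown (op1 built y (status-y sy)) (attach {y = y} E fresh pv (sym sv))
    go CB sy sv = 3 , grown (op3 built y (status-y sy))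
      (embedding-≈ chain⊆op3 op3⊆chain (proj₂ (attach-chain {y = y} E sy fresh pv)))

  -- Climb from `v` through fresh vertices until the parent lies in the image. The bound `k` on the
  -- depth drives the recursion, and the root, being in the image, is never passed.
  frontier : ∀ {fs : Edges m} {st φ} → Embedding fs st φ → ∀ k {v} → depth v < k → Fresh φ v →
             ∃₂ λ w y → Fresh φ w × parent w ≡ φ y
  frontier {φ = φ} E (suc k) {v} (s≤s d≤k) fresh with any? (λ y → φ y ≟ parent v)
  ... | yes (y , φy≡pv) = v , y , fresh , sym φy≡pv
  ... | no miss = frontier E k (ℕ.<-≤-trans (depth-parent (fresh≢root E fresh)) d≤k) λ y φy≡pv → miss (y , φy≡pv)

  -- Every edge of `es` joins a vertex to its parent, and `parent-in` provides that edge in `fs`; so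
  -- the bijective homomorphism is an isomorphism.
  finish : ∀ {fs : Edges m} {st φ} → Built m fs st → Embedding fs st φ → (∀ v → ∃ λ x → φ x ≡ v) → InFamily es
  finish {fs = fs} {φ = φ} built E onto = _ , _ , _ , built , mk↔ₛ′ ψ φ (λ x → injective (φψ (φ x))) φψ ,
    λ x y → mk⇔ reflect λ xy → subst (λ z → Adj es z y) (φψ x) (subst (Adj es (φ (ψ x))) (φψ y) (hom xy))
    where
    open Embedding E
    ψ : Fin n → _
    ψ v = proj₁ (onto v)

    φψ : ∀ v → φ (ψ v) ≡ v
    φψ v = proj₂ (onto v)

    up : ∀ {x y} → x ≢ r → parent x ≡ y → Adj fs (ψ x) (ψ y)
    up {x} {y} x≢r px with parent-in (ψ x)
    ... | inj₁ φψx≡r = contradiction (trans (sym (φψ x)) φψx≡r) x≢r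
    ... | inj₂ (z , φz , xz) = subst (Adj fs (ψ x))
      (injective (trans φz (trans (cong parent (φψ x)) (trans px (sym (φψ y)))))) xz

    reflect : ∀ {x y} → Adj es x y → Adj fs (ψ x) (ψ y)
    reflect xy with adj-cases xy
    ... | inj₁ (x≢r , px) = up x≢r px
    ... | inj₂ (y≢r , py) = Sum.swap (up y≢r py)

  -- The fuel `k` bounds the number of vertices still missing. When it is zero, a missed vertex
  -- would force `m < n`.
  grow : ∀ k → n ≤ m + k → Grown m → InFamily es
  grow {m} k n≤m+k (grown {φ = φ} built E) with any? (λ v → ¬? (any? (λ x → φ x ≟ v)))
  ... | no covered = finish built E λ v → decidable-stable (any? (λ x → φ x ≟ v)) λ fresh → covered (v , fresh)
  ... | yes (v , fresh) = continue k n≤m+k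
    where
    continue : ∀ k → n ≤ m + k → InFamily es
    continue zero n≤m = contradiction
      (non-surjective⇒< (Embedding.injective E) v λ x φx≡v → fresh (x , φx≡v))
      (ℕ.≤⇒≯ (subst (n ≤_) (ℕ.+-identityʳ m) n≤m))
    continue (suc k) n≤ =
      let w , y , fresh′ , pw = frontier E (suc (depth v)) ℕ.≤-refl λ x φx≡v → fresh (x , φx≡v)
          j , larger = step {y = y} built E fresh′ pw
      in grow k (ℕ.≤-trans n≤ (ℕ.≤-trans (ℕ.≤-reflexive (ℕ.+-suc m k)) (s≤s (ℕ.+-monoˡ-≤ k (ℕ.m≤n+m m j))))) larger

-- Some end of an edge has status `B`, hence a `C`-neighbour. Rooting there lets the initial path
-- descend from the root as a chain.
labelling⇒family : ∀ {st} → IsTree n es → Labelling es st → es ≢ [] → InFamily es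
labelling⇒family {n = n} {es = es} {st} T L es≢[] =
  let b , sb = vertexB es refl
      c , bc , sc = hasC sb
      open Growth L (rooted T c)
  in grow n (ℕ.m≤n+m n 5) (seed sc (Sum.swap bc))
  where
  open Labelling L
  endpoint : ∀ {u v s t} → Compatible s t → st u ≡ s → st v ≡ t → ∃ λ b → st b ≡ B
  endpoint AB _ sv = _ , sv
  endpoint BA su _ = _ , su
  endpoint BC su _ = _ , su
  endpoint CB _ sv = _ , sv

  vertexB : ∀ fs → es ≡ fs → ∃ λ b → st b ≡ B
  vertexB [] es≡[] = contradiction es≡[] es≢[]
  vertexB ((u , v) ∷ _) refl = endpoint (compatible (inj₁ (here refl))) refl refl

theorem4p11 : ∀ (n : ℕ) (es : Edges n) → IsTree n es → (IotaCritical es ⇔ InFamily es)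
theorem4p11 n es T = mk⇔
  (λ critical → labelling⇒family T (proj₂ (critical⇒labelling T critical)) (proj₁ critical))
  (family⇒critical T)
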